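{- Let $H$ be a target graph, possibly with loops. Suppose there is an ordering $H^1,\ldots,H^k$ of the automorphic similarity classes of $H$ such that the associated automorphic similarity matrix $M$ has the increasing columns property. Then $H$ is Hoffman-London.
   Context: All graphs are finite. A target graph $H$ is a graph without multiple edges but possibly with loops. For a simple loopless graph $G$, an $H$-coloring of $G$ is a map $f:V(G)\to V(H)$ such that $f(u)\sim_H f(v)$ whenever $u\sim_G v$; $\hom(G,H)$ denotes the number of $H$-colorings of $G$. $\mathcal{T}_n$ is the set of all trees on $n$ vertices (up to isomorphism) and $P_n\in\mathcal{T}_n$ is the path on $n$ vertices. $H$ is Hoffman-London if for all $n\ge 1$, $\hom(P_n,H)=\min_{T_n\in\mathcal{T}_n}\hom(T_n,H)$. Vertices $u,v$ of $H$ are automorphically similar if some automorphism of $H$ maps $u$ to $v$; this is an equivalence relation on $V(H)$, whose classes (the orbits of the automorphism group) are the automorphic similarity classes $H^1,\ldots,H^k$. For all $i,j$ every vertex of $H^i$ has the same number $m_{i,j}$ of neighbors in $H^j$ (a looped vertex is a neighbor of itself, counted once). The automorphic similarity matrix of $H$ relative to the ordering $H^1,\ldots,H^k$ is the $k\times k$ matrix $M$ with $(i,j)$-entry $m_{i,j}$. A $k\times k$ matrix $M=(m_{i,j})$ has the increasing columns property if for each $1\le c\le k$ and each $1\le i\le k-1$, $\sum_{j=c}^k m_{i,j}\le\sum_{j=c}^k m_{i+1,j}$. -}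

module Defs where

open import Data.Fin.Base using (Fin; zero; suc; toℕ; inject₁; fromℕ; finToFun)
open import Data.Fin.Permutation using (Permutation′; _⟨$⟩ʳ_)
open import Data.Fin.Properties using (_≟_; _≤?_; all?)
import Data.List.Base as List hiding (sum)
open import Data.Nat.Base using (ℕ; zero; suc; _+_; _^_; _≤_; NonZero)
import Data.Nat.ListAction as List
import Data.Nat.Properties as ℕ
open import Data.Product.Base using (_×_; _,_; ∃; ∃-syntax; proj₁; proj₂)
open import Data.Sum.Base using (_⊎_; inj₁; inj₂; swap)
open import Data.Vec.Base using (allFin; count; tabulate)
open import Function.Base using (_∘_; id)
open import Function.Bundles using (_⇔_; mk⇔; Equivalence)
open import Function.Definitions using (Injective; StrictlySurjective)
open import Level using (0ℓ)
open import Relation.Binary.Core using (Rel)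
open import Relation.Binary.Definitions using (Decidable; Symmetric)
open import Relation.Binary.Construct.Closure.ReflexiveTransitive using (Star)
open import Relation.Binary.PropositionalEquality
open import Relation.Nullary using (Dec; yes; no; ¬_; contradiction)
open import Relation.Nullary.Decidable using (_×-dec_; _⊎-dec_; _→-dec_)
import Relation.Unary as Unary
open import Algebra.Properties.CommutativeMonoid.Sum ℕ.+-0-commutativeMonoid
  using (sum; sum-cong-≗; sum-permute)

private
  variable
    k m n : ℕ

-- The vertex set is Fin n.  Loops are allowed: u ∼ u is neither required nor
-- excluded.
record Graph (n : ℕ) : Set₁ where
  field
    _∼_   : Rel (Fin n) 0ℓ
    _∼?_  : Decidable _∼_
    ∼-sym : Symmetric _∼_

TargetGraph : ℕ → Set₁
TargetGraph = Graph

record SimpleGraph (n : ℕ) : Set₁ where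
  field
    graph    : Graph n
  open Graph graph public
  field
    loopless : ∀ {v} → ¬ v ∼ v

module _ (G : SimpleGraph n) where
  open SimpleGraph G

  Connected : Set
  Connected = ∀ u v → Star _∼_ u v

  -- The cycle has length ℓ + 3.
  record Cycle : Set where
    field
      ℓ        : ℕ
      vertex   : Fin (3 + ℓ) → Fin n
      distinct : Injective _≡_ _≡_ vertex
      step     : ∀ i → vertex (inject₁ i) ∼ vertex (suc i)
      close    : vertex (fromℕ (2 + ℓ)) ∼ vertex zero

  Acyclic : Set
  Acyclic = ¬ Cycle

  -- Nonemptiness is not included here; trees are only used on n ≥ 1 vertices.
  IsTree : Set
  IsTree = Connected × Acyclic

path : ∀ n → SimpleGraph n
path n = record
  { graph = record
    { _∼_   = λ i j → suc (toℕ i) ≡ toℕ j ⊎ suc (toℕ j) ≡ toℕ i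
    ; _∼?_  = λ i j → (suc (toℕ i) ℕ.≟ toℕ j) ⊎-dec (suc (toℕ j) ℕ.≟ toℕ i)
    ; ∼-sym = swap
    }
  ; loopless = λ where
      (inj₁ eq) → ℕ.1+n≢n eq
      (inj₂ eq) → ℕ.1+n≢n eq
  }

module _ (G : SimpleGraph n) (H : TargetGraph m) where
  private
    module G = SimpleGraph G
    module H = Graph H

  IsColoring : (Fin n → Fin m) → Set
  IsColoring f = ∀ u v → u G.∼ v → f u H.∼ f v

  isColoring? : Unary.Decidable IsColoring
  isColoring? f = all? λ u → all? λ v → (u G.∼? v) →-dec (f u H.∼? f v)

  -- finToFun is the library's bijection between Fin (m ^ n) and Fin n → Fin m,
  -- so each map is counted once.
  hom : ℕ
  hom = count (λ c → isColoring? (finToFun c)) (allFin (m ^ n))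

IsMinimumOver : ∀ {a p} {A : Set a} → (A → Set p) → (A → ℕ) → ℕ → Set _
IsMinimumOver P f x = (∃[ a ] P a × f a ≡ x) × (∀ a → P a → x ≤ f a)

-- Trees are labelled by Fin n; hom is invariant under relabelling, so this is
-- the minimum over isomorphism classes.
HoffmanLondon : TargetGraph m → Set₁
HoffmanLondon H =
  ∀ n → .{{NonZero n}} → IsMinimumOver (IsTree {n}) (λ T → hom T H) (hom (path n) H)

module _ (H : TargetGraph m) where
  open Graph H

  IsAutomorphism : Permutation′ m → Set
  IsAutomorphism π = ∀ u v → u ∼ v ⇔ (π ⟨$⟩ʳ u) ∼ (π ⟨$⟩ʳ v)

  Similar : Rel (Fin m) 0ℓ
  Similar u v = ∃[ π ] IsAutomorphism π × π ⟨$⟩ʳ u ≡ v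

  -- An ordering H¹, …, Hᵏ of the similarity classes, given by the index of the
  -- class of each vertex.
  record ClassOrdering (k : ℕ) : Set where
    field
      class            : Fin m → Fin k
      class-surjective : StrictlySurjective _≡_ class
      class-similar    : ∀ u v → class u ≡ class v ⇔ Similar u v

    representative : Fin k → Fin m
    representative i = proj₁ (class-surjective i)

    neighbourInClass? : ∀ u j → Unary.Decidable (λ v → u ∼ v × class v ≡ j)
    neighbourInClass? u j v = (u ∼? v) ×-dec (class v ≟ j)

    neighboursIn : Fin m → Fin k → ℕ
    neighboursIn u j = count (neighbourInClass? u j) (allFin m)

Matrix : ℕ → Set
Matrix k = Fin k → Fin k → ℕ

-- The choice of representative is immaterial, by similarityMatrix-class below.
similarityMatrix : (H : TargetGraph m) → ClassOrdering H k → Matrix k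
similarityMatrix H 𝒪 i j = neighboursIn (representative i) j
  where open ClassOrdering 𝒪

tailSum : Fin k → (Fin k → ℕ) → ℕ
tailSum c v = List.sum (List.map v (List.filter (c ≤?_) (List.allFin _)))

IncreasingColumns : Matrix k → Set
IncreasingColumns {k} M =
  ∀ (c i i′ : Fin k) → toℕ i′ ≡ suc (toℕ i) → tailSum c (M i) ≤ tailSum c (M i′)

private
  indicator : ∀ {P : Set} → Dec P → ℕ
  indicator (yes _) = 1
  indicator (no  _) = 0

  indicator-⇔ : ∀ {P Q : Set} → P ⇔ Q → (P? : Dec P) (Q? : Dec Q) →
                indicator P? ≡ indicator Q?
  indicator-⇔ P⇔Q (yes p) (yes q) = refl
  indicator-⇔ P⇔Q (yes p) (no ¬q) = contradiction (Equivalence.to P⇔Q p) ¬q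
  indicator-⇔ P⇔Q (no ¬p) (yes q) = contradiction (Equivalence.from P⇔Q q) ¬p
  indicator-⇔ P⇔Q (no ¬p) (no ¬q) = refl

  count-tabulate : ∀ {A : Set} {P : A → Set} (P? : Unary.Decidable P)
                   (f : Fin n → A) →
                   count P? (tabulate f) ≡ sum (λ i → indicator (P? (f i)))
  count-tabulate {n = zero}  P? f = refl
  count-tabulate {n = suc n} P? f with P? (f zero)
  ... | yes _ = cong suc (count-tabulate P? (f ∘ suc))
  ... | no  _ = count-tabulate P? (f ∘ suc)

module _ (H : TargetGraph m) (𝒪 : ClassOrdering H k) where
  open Graph H
  open ClassOrdering 𝒪

  neighboursIn-similar : ∀ {u v} → Similar H u v →
                         ∀ j → neighboursIn u j ≡ neighboursIn v j
  neighboursIn-similar {u} (π , aut , refl) j = begin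
    neighboursIn u j
      ≡⟨ count-tabulate (neighbourInClass? u j) id ⟩
    sum (λ w → indicator (neighbourInClass? u j w))
      ≡⟨ sum-cong-≗ (λ w → indicator-⇔ (mk⇔ (to w) (from w)) _ _) ⟩
    sum (λ w → indicator (neighbourInClass? (π ⟨$⟩ʳ u) j (π ⟨$⟩ʳ w)))
      ≡⟨ sum-permute (λ w → indicator (neighbourInClass? (π ⟨$⟩ʳ u) j w)) π ⟨
    sum (λ w → indicator (neighbourInClass? (π ⟨$⟩ʳ u) j w))
      ≡⟨ count-tabulate (neighbourInClass? (π ⟨$⟩ʳ u) j) id ⟨
    neighboursIn (π ⟨$⟩ʳ u) j ∎
    where
    open ≡-Reasoning
    class-π : ∀ w → class w ≡ class (π ⟨$⟩ʳ w)
    class-π w = Equivalence.from (class-similar w _) (π , aut , refl)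
    to : ∀ w → u ∼ w × class w ≡ j →
         (π ⟨$⟩ʳ u) ∼ (π ⟨$⟩ʳ w) × class (π ⟨$⟩ʳ w) ≡ j
    to w (adj , eq) = Equivalence.to (aut u w) adj , trans (sym (class-π w)) eq
    from : ∀ w → (π ⟨$⟩ʳ u) ∼ (π ⟨$⟩ʳ w) × class (π ⟨$⟩ʳ w) ≡ j →
           u ∼ w × class w ≡ j
    from w (adj , eq) = Equivalence.from (aut u w) adj , trans (class-π w) eq

  similarityMatrix-class : ∀ u j →
                           similarityMatrix H 𝒪 (class u) j ≡ neighboursIn u j
  similarityMatrix-class u =
    neighboursIn-similar
      (Equivalence.to (class-similar _ u) (proj₂ (class-surjective (class u))))

{-# OPTIONS --safe #-}

-- Give every vertex v of a tree a weight w v : V(H) → ℕ and let Z be the sum of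
-- ∏ᵥ w v (f v) over all H-colorings f.  With A the adjacency operator of H,
-- removing a leaf ℓ at p leaves Z unchanged when w p is multiplied by A (w ℓ).
-- By the increasing columns property A preserves the functions on V(H) that
-- increase with the class.  Write f ≽ g (g ≼ f) if ⟨ g , h ⟩ ≤ ⟨ f , h ⟩ for all
-- increasing h.  Since Aʲ is symmetric, Chebyshev's rearrangement gives
-- Aʲ g ≼ g · Aʲ 1 for increasing g.  Hence increasing f ≽ Aⁱ 1 and g ≽ Aʲ 1 have
-- f · A g ≽ Aⁱ⁺ʲ⁺¹ 1, so removing leaves until one vertex remains bounds Z from
-- below by ⟨ Aⁿ⁻¹ 1 , 1 ⟩, which is the number of colorings of the path.
module Submission where

open import Defs
import Algebra.Properties.CommutativeMonoid.Sum as MonoidSum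
open import Data.Bool.Base using (if_then_else_; true; false)
open import Data.Empty using (⊥)
open import Data.Fin.Base as Fin
  using (Fin; zero; suc; toℕ; fromℕ; inject₁; punchIn; punchOut; combine; finToFun; _↑ˡ_; _↑ʳ_)
open import Data.Fin.Properties
  using (_≟_; _≤?_; all?; any?; ¬∀⟶∃¬; pigeonhole; punchIn-injective; punchInᵢ≢i;
         punchIn-punchOut; toℕ-injective; toℕ-inject₁; toℕ-fromℕ; toℕ<n; remQuot-combine)
  renaming (suc-injective to Fin-suc-injective)
open import Data.Fin.Relation.Unary.Top using (view; ‵fromℕ; ‵inject₁)
import Data.List.Base as List hiding (sum)
open import Data.Nat.Base
open import Data.Nat.Induction using (<-rec)
import Data.Nat.ListAction as List
open import Data.Nat.Properties as ℕ hiding (_≟_; _≤?_)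
open import Data.Nat.Tactic.RingSolver using (solve-∀)
open import Data.Product.Base using (_×_; _,_; ∃-syntax; ∃₂; proj₁; proj₂)
open import Data.Sum.Base using (inj₁; inj₂)
import Data.Vec.Base as Vec
open import Data.Vec.Functional using (_∷_; insertAt; removeAt; updateAt)
open import Data.Vec.Functional.Properties using (insertAt-lookup; insertAt-punchIn)
open import Function.Base using (_∘_; id; const)
open import Function.Bundles using (_⇔_; mk⇔; Equivalence)
open import Relation.Binary.Construct.Closure.ReflexiveTransitive using (Star; ε; _◅_; _◅◅_; gmap)
open import Relation.Binary.Definitions using (tri<; tri≈; tri>)
open import Relation.Binary.PropositionalEquality
open import Relation.Nullary using (Dec; yes; no; ¬_; does; contradiction)
open import Relation.Nullary.Decidable using (_×-dec_; _→-dec_; decidable-stable; dec-true)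
import Relation.Unary as Unary

open import Algebra.Properties.Semiring.Sum ℕ.+-*-semiring
  using (*-distribˡ-sum; *-distribʳ-sum)
open MonoidSum ℕ.+-0-commutativeMonoid
  using (sum; sum-cong-≗; sum-remove; ∑-distrib-+; ∑-comm; sum-replicate-zero)
open MonoidSum ℕ.*-1-commutativeMonoid
  using ()
  renaming (sum to product; sum-cong-≗ to product-cong-≗; sum-remove to product-remove;
            sum-replicate-zero to product-replicate-one)

private
  variable
    k m n : ℕ

-- Finite sums

sum-mono : {f g : Fin n → ℕ} → (∀ i → f i ≤ g i) → sum f ≤ sum g
sum-mono {zero}  f≤g = z≤n
sum-mono {suc n} f≤g = +-mono-≤ (f≤g zero) (sum-mono (f≤g ∘ suc))

sum-++ : (f : Fin (m + n) → ℕ) →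
         sum f ≡ sum (λ i → f (i ↑ˡ n)) + sum (λ j → f (m ↑ʳ j))
sum-++ {zero}  f = refl
sum-++ {suc m} f = trans (cong (f zero +_) (sum-++ {m} (f ∘ suc))) (sym (+-assoc (f zero) _ _))

sum-combine : (f : Fin (m * n) → ℕ) → sum f ≡ sum {m} λ i → sum {n} λ j → f (combine i j)
sum-combine {zero}      f = refl
sum-combine {suc m} {n} f =
  trans (sum-++ {n} f) (cong (sum (λ j → f (j ↑ˡ (m * n))) +_) (sum-combine {m} (f ∘ (n ↑ʳ_))))

-- Associativity of a row vector, a matrix and a column vector, by exchanging the two sums.
sum-*-assoc : (x : Fin m → ℕ) (k : Fin m → Fin n → ℕ) (y : Fin n → ℕ) →
              sum (λ i → x i * sum (λ j → k i j * y j)) ≡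
              sum (λ j → sum (λ i → x i * k i j) * y j)
sum-*-assoc {m} {n} x k y = begin
  sum (λ i → x i * sum (λ j → k i j * y j))
    ≡⟨ sum-cong-≗ {m} (λ i → *-distribˡ-sum {n} (x i) _) ⟩
  sum (λ i → sum (λ j → x i * (k i j * y j)))
    ≡⟨ ∑-comm {m} {n} _ ⟩
  sum (λ j → sum (λ i → x i * (k i j * y j)))
    ≡⟨ sum-cong-≗ {n} (λ j → sum-cong-≗ {m} (λ i → sym (*-assoc (x i) _ _))) ⟩
  sum (λ j → sum (λ i → x i * k i j * y j))
    ≡⟨ sum-cong-≗ {n} (λ j → *-distribʳ-sum {m} (y j) _) ⟨
  sum (λ j → sum (λ i → x i * k i j) * y j) ∎
  where open ≡-Reasoning

-- Symmetrisation: twice a double sum is the sum of `h i j + h j i`, so it is enough to compare the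
-- entries at `(i , j)` and `(j , i)` together.
double-sum-mono : (f g : Fin n → Fin n → ℕ) →
                  (∀ i j → f i j + f j i ≤ g i j + g j i) →
                  sum (λ i → sum (f i)) ≤ sum (λ i → sum (g i))
double-sum-mono f g f≤g =
  *-cancelˡ-≤ 2 (subst₂ _≤_ (twice f) (twice g) (sum-mono λ i → sum-mono (f≤g i)))
  where
  open ≡-Reasoning
  twice : ∀ h → sum (λ i → sum (λ j → h i j + h j i)) ≡ 2 * sum (λ i → sum (h i))
  twice h = begin
    sum (λ i → sum (λ j → h i j + h j i))
      ≡⟨ sum-cong-≗ (λ i → ∑-distrib-+ (h i) (λ j → h j i)) ⟩
    sum (λ i → sum (h i) + sum (λ j → h j i))
      ≡⟨ ∑-distrib-+ (λ i → sum (h i)) _ ⟩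
    sum (λ i → sum (h i)) + sum (λ i → sum (λ j → h j i))
      ≡⟨ cong₂ _+_ refl (trans (∑-comm (λ i j → h j i)) (sym (+-identityʳ _))) ⟩
    2 * sum (λ i → sum (h i)) ∎

sum-updateAt-+ : (f : Fin n → ℕ) (i : Fin n) (x : ℕ) → sum (updateAt f i (x +_)) ≡ x + sum f
sum-updateAt-+ f zero    x = +-assoc x _ _
sum-updateAt-+ f (suc i) x =
  trans (cong (f zero +_) (sum-updateAt-+ (f ∘ suc) i x)) (swap (f zero) x _)
  where
  swap : ∀ a b c → a + (b + c) ≡ b + (a + c)
  swap = solve-∀

product-updateAt : {B : Set} (w : Fin n → B → ℕ) (i : Fin n) (g : B → ℕ) (f : Fin n → B) →
                   product (λ j → updateAt w i (λ h b → h b * g b) j (f j)) ≡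
                   product (λ j → w j (f j)) * g (f i)
product-updateAt w zero    g f = swap (w zero (f zero)) (g (f zero)) _
  where
  swap : ∀ a b c → a * b * c ≡ a * c * b
  swap = solve-∀
product-updateAt w (suc i) g f =
  trans (cong (w zero (f zero) *_) (product-updateAt (w ∘ suc) i g (f ∘ suc)))
        (sym (*-assoc (w zero (f zero)) _ _))

-- The two sides differ by `(b - a) * (d - c)`, which becomes `p * q` after substituting `b = a + p`
-- and `d = c + q`.
rearrangement : ∀ {a b c d} → a ≤ b → c ≤ d → b * c + a * d ≤ a * c + b * d
rearrangement {a} {b} {c} {d} a≤b c≤d
  with p , refl ← m≤n⇒∃[o]m+o≡n a≤b | q , refl ← m≤n⇒∃[o]m+o≡n c≤d =
  ≤-trans (m≤m+n _ (p * q)) (≤-reflexive (expand a p c q))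
  where
  expand : ∀ a p c q → (a + p) * c + a * (c + q) + p * q ≡ a * c + (a + p) * (c + q)
  expand = solve-∀

-- Indicators

-- Only the Boolean `does P?` is inspected, so `ι (suc i ≟ suc j)` computes to `ι (i ≟ j)`, as
-- `sum-ι-≟` relies on.
ι : {P : Set} → Dec P → ℕ
ι P? = if does P? then 1 else 0

ι-⇔ : {P Q : Set} → P ⇔ Q → (P? : Dec P) (Q? : Dec Q) → ι P? ≡ ι Q?
ι-⇔ P⇔Q (yes p) (yes q) = refl
ι-⇔ P⇔Q (yes p) (no ¬q) = contradiction (Equivalence.to P⇔Q p) ¬q
ι-⇔ P⇔Q (no ¬p) (yes q) = contradiction (Equivalence.from P⇔Q q) ¬p
ι-⇔ P⇔Q (no ¬p) (no ¬q) = refl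

ι-× : {P Q : Set} (P? : Dec P) (Q? : Dec Q) → ι (P? ×-dec Q?) ≡ ι P? * ι Q?
ι-× (yes _) (yes _) = refl
ι-× (yes _) (no _)  = refl
ι-× (no _)  _       = refl

count-tabulate : {B : Set} {P : B → Set} (P? : Unary.Decidable P) (f : Fin n → B) →
                 Vec.count P? (Vec.tabulate f) ≡ sum (λ i → ι (P? (f i)))
count-tabulate {n = zero}  P? f = refl
count-tabulate {n = suc n} P? f with does (P? (f zero))
... | true  = cong suc (count-tabulate P? (f ∘ suc))
... | false = count-tabulate P? (f ∘ suc)

sum-filter-tabulate : {B : Set} {P : B → Set} (P? : Unary.Decidable P) (v : B → ℕ) (f : Fin n → B) →
                      List.sum (List.map v (List.filter P? (List.tabulate f))) ≡
                      sum (λ i → ι (P? (f i)) * v (f i))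
sum-filter-tabulate {n = zero}  P? v f = refl
sum-filter-tabulate {n = suc n} P? v f with does (P? (f zero))
... | true  = cong₂ _+_ (sym (+-identityʳ _)) (sum-filter-tabulate P? v (f ∘ suc))
... | false = sum-filter-tabulate P? v (f ∘ suc)

sum-ι-≟ : (i : Fin n) (x : Fin n → ℕ) → sum (λ j → ι (i ≟ j) * x j) ≡ x i
sum-ι-≟ {suc n} zero    x = begin
  1 * x zero + sum (λ (j : Fin n) → 0) ≡⟨ cong₂ _+_ (*-identityˡ _) (sum-replicate-zero n) ⟩
  x zero + 0                ≡⟨ +-identityʳ _ ⟩
  x zero                    ∎
  where open ≡-Reasoning
sum-ι-≟ (suc i) x = sum-ι-≟ i (x ∘ suc)

-- Tail sums

tailSum-ι : (c : Fin k) (x : Fin k → ℕ) → tailSum c x ≡ sum (λ j → ι (c ≤? j) * x j)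
tailSum-ι c x = sum-filter-tabulate (c ≤?_) x id

tailSum-zero : (x : Fin (suc k) → ℕ) → tailSum zero x ≡ sum x
tailSum-zero x = trans (tailSum-ι zero x) (sum-cong-≗ λ j → *-identityˡ (x j))

tailSum-suc : (c : Fin k) (x : Fin (suc k) → ℕ) → tailSum (suc c) x ≡ tailSum c (x ∘ suc)
tailSum-suc c x = begin
  tailSum (suc c) x
    ≡⟨ tailSum-ι (suc c) x ⟩
  sum (λ j → ι (suc c ≤? suc j) * x (suc j))
    ≡⟨ sum-cong-≗ (λ j → cong (_* x (suc j)) (ι-⇔ (mk⇔ s≤s⁻¹ s≤s) (suc c ≤? suc j) (c ≤? j))) ⟩
  sum (λ j → ι (c ≤? j) * x (suc j))
    ≡⟨ tailSum-ι c (x ∘ suc) ⟨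
  tailSum c (x ∘ suc) ∎
  where open ≡-Reasoning

Monotone : (Fin k → ℕ) → Set
Monotone {k} g = {i j : Fin k} → toℕ i ≤ toℕ j → g i ≤ g j

-- Abel summation: splitting off g 0 leaves the weights g (suc j) ∸ g 0, again monotone.
tailSum-dominance : {x y g : Fin k → ℕ} → Monotone g →
                    (∀ c → tailSum c x ≤ tailSum c y) →
                    sum (λ j → x j * g j) ≤ sum (λ j → y j * g j)
tailSum-dominance {zero}                  mono x≤y = z≤n
tailSum-dominance {suc k} {x} {y} {g} mono x≤y =
  subst₂ _≤_ (sym (split x)) (sym (split y))
    (+-mono-≤
      -- The tail at `zero` is the whole sum and settles the constant part `g zero`; the tails at
      -- `suc c` feed the induction.
      (*-monoˡ-≤ (g zero) (subst₂ _≤_ (tailSum-zero x) (tailSum-zero y) (x≤y zero)))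
      (tailSum-dominance (λ i≤j → ∸-monoˡ-≤ (g zero) (mono (s≤s i≤j)))
        (λ c → subst₂ _≤_ (tailSum-suc c x) (tailSum-suc c y) (x≤y (suc c)))))
  where
  open ≡-Reasoning
  split : ∀ z → sum (λ j → z j * g j) ≡
                sum z * g zero + sum (λ j → z (suc j) * (g (suc j) ∸ g zero))
  split z = begin
    sum (λ j → z j * g j)
      ≡⟨ sum-cong-≗ {suc k} (λ j → trans (cong (z j *_) (sym (m+[n∸m]≡n (mono {zero} {j} z≤n))))
                                 (*-distribˡ-+ (z j) (g zero) (g j ∸ g zero))) ⟩
    sum (λ j → z j * g zero + z j * (g j ∸ g zero))
      ≡⟨ ∑-distrib-+ {suc k} (λ j → z j * g zero) (λ j → z j * (g j ∸ g zero)) ⟩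
    sum (λ j → z j * g zero) + sum (λ j → z j * (g j ∸ g zero))
      ≡⟨ cong₂ _+_ (sym (*-distribʳ-sum (g zero) z))
           (cong (λ d → z zero * d + rest) (n∸n≡0 (g zero))) ⟩
    sum z * g zero + (z zero * 0 + rest)
      ≡⟨ cong (λ d → sum z * g zero + (d + rest)) (*-zeroʳ (z zero)) ⟩
    sum z * g zero + rest ∎
    where rest = sum (λ j → z (suc j) * (g (suc j) ∸ g zero))

steps⇒Monotone : (g : Fin k → ℕ) → (∀ i j → toℕ j ≡ suc (toℕ i) → g i ≤ g j) → Monotone g
steps⇒Monotone g step {zero}  {zero}  _ = ≤-refl
steps⇒Monotone {suc (suc k)} g step {zero} {suc j} _ =
  ≤-trans (step zero (suc zero) refl)
          (steps⇒Monotone (g ∘ suc) (λ i j eq → step (suc i) (suc j) (cong suc eq)) {zero} {j} z≤n)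
steps⇒Monotone g step {suc i} {suc j} (s≤s i≤j) =
  steps⇒Monotone (g ∘ suc) (λ i j eq → step (suc i) (suc j) (cong suc eq)) i≤j

-- Increasing functions and symmetric kernels

⟨_,_⟩ : (Fin m → ℕ) → (Fin m → ℕ) → ℕ
⟨ f , g ⟩ = sum (λ u → f u * g u)

infixl 7 _·_
_·_ : (Fin m → ℕ) → (Fin m → ℕ) → Fin m → ℕ
(f · g) u = f u * g u

module Increasing {m} (rank : Fin m → ℕ) where

  -- Vertices of equal rank are compared in both directions, so such a function is constant on each
  -- rank level. With the class index as rank it is a function of the class.
  Increasing : (Fin m → ℕ) → Set
  Increasing w = ∀ {u v} → rank u ≤ rank v → w u ≤ w v

  ·-increasing : ∀ {f g} → Increasing f → Increasing g → Increasing (f · g)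
  ·-increasing f↑ g↑ u≤v = *-mono-≤ (f↑ u≤v) (g↑ u≤v)

  -- Since `k` is symmetric, the pairs `(u , v)` and `(v , u)` carry the same factor `k u v`. What
  -- remains for the pair is the rearrangement inequality, as `f` and `g` are ordered alike by rank.
  chebyshev : (k : Fin m → Fin m → ℕ) → (∀ u v → k u v ≡ k v u) →
              ∀ {f g} → Increasing f → Increasing g →
              ⟨ (λ u → sum (λ v → k u v * f v)) , g ⟩ ≤ ⟨ f · (λ u → sum (k u)) , g ⟩
  chebyshev k k-sym {f} {g} f↑ g↑ =
    subst₂ _≤_ (sum-cong-≗ {m} λ u → sym (*-distribʳ-sum {m} (g u) _))
               (sum-cong-≗ {m} λ u → sym (diagonal u))
      (double-sum-mono (λ u v → k u v * f v * g u) (λ u v → f u * k u v * g u) pointwise)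
    where
    diagonal : ∀ u → f u * sum (k u) * g u ≡ sum (λ v → f u * k u v * g u)
    diagonal u = trans (cong (_* g u) (*-distribˡ-sum (f u) (k u))) (*-distribʳ-sum {m} (g u) _)
    lhs : ∀ κ a b c d → κ * b * c + κ * a * d ≡ κ * (b * c + a * d)
    lhs = solve-∀
    rhs : ∀ κ a b c d → a * κ * c + b * κ * d ≡ κ * (a * c + b * d)
    rhs = solve-∀
    comonotone : ∀ u v → f v * g u + f u * g v ≤ f u * g u + f v * g v
    comonotone u v with ≤-total (rank u) (rank v)
    ... | inj₁ u≤v = rearrangement (f↑ u≤v) (g↑ u≤v)
    ... | inj₂ v≤u =
      subst₂ _≤_ (+-comm (f u * g v) _) (+-comm (f v * g v) _) (rearrangement (f↑ v≤u) (g↑ v≤u))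
    pointwise : ∀ u v → k u v * f v * g u + k v u * f u * g v ≤
                        f u * k u v * g u + f v * k v u * g v
    pointwise u v rewrite k-sym v u =
      subst₂ _≤_ (sym (lhs (k u v) (f u) (f v) (g u) (g v)))
                 (sym (rhs (k u v) (f u) (f v) (g u) (g v)))
                 (*-monoʳ-≤ (k u v) (comonotone u v))

module SymmetricKernel {m} (a : Fin m → Fin m → ℕ) (a-sym : ∀ u v → a u v ≡ a v u) where

  A : (Fin m → ℕ) → Fin m → ℕ
  A w u = sum (λ v → a u v * w v)

  A^ : ℕ → (Fin m → ℕ) → Fin m → ℕ
  A^ zero    w = w
  A^ (suc i) w = A (A^ i w)

  -- For an adjacency matrix, `q i u` is the number of walks with `i` steps that start at `u`.
  q : ℕ → Fin m → ℕ
  q i = A^ i (const 1)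

  A^-+ : ∀ i j w → A^ (i + j) w ≡ A^ i (A^ j w)
  A^-+ zero    j w = refl
  A^-+ (suc i) j w = cong A (A^-+ i j w)

  A-selfAdjoint : ∀ f g → ⟨ A f , g ⟩ ≡ ⟨ f , A g ⟩
  A-selfAdjoint f g = begin
    sum (λ u → sum (λ v → a u v * f v) * g u)
      ≡⟨ sum-cong-≗ (λ u → cong (_* g u) (sum-cong-≗ λ v →
           trans (*-comm (a u v) (f v)) (cong (f v *_) (a-sym u v)))) ⟩
    sum (λ u → sum (λ v → f v * a v u) * g u)
      ≡⟨ sum-*-assoc f a g ⟨
    ⟨ f , A g ⟩ ∎
    where open ≡-Reasoning

  -- The kernel of A^ (suc i); starting from the first power avoids the identity kernel.
  kernel : ℕ → Fin m → Fin m → ℕ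
  kernel zero    u v = a u v
  kernel (suc i) u v = sum (λ x → a u x * kernel i x v)

  A^-kernel : ∀ i w u → A^ (suc i) w u ≡ sum (λ v → kernel i u v * w v)
  A^-kernel zero    w u = refl
  A^-kernel (suc i) w u =
    trans (sum-cong-≗ λ x → cong (a u x *_) (A^-kernel i w x)) (sum-*-assoc (a u) (kernel i) w)

  -- `kernel` multiplies by `a` on the left, and transposing moves that factor to the right; hence
  -- symmetry needs both recursions.
  kernel-sucʳ : ∀ i u v → kernel (suc i) u v ≡ sum (λ x → kernel i u x * a x v)
  kernel-sucʳ zero    u v = refl
  kernel-sucʳ (suc i) u v =
    trans (sum-cong-≗ λ x → cong (a u x *_) (kernel-sucʳ i x v))
          (sum-*-assoc (a u) (kernel i) (λ y → a y v))

  kernel-sym : ∀ i u v → kernel i u v ≡ kernel i v u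
  kernel-sym zero    u v = a-sym u v
  kernel-sym (suc i) u v =
    trans (sum-cong-≗ λ x → trans (*-comm (a u x) _) (cong₂ _*_ (kernel-sym i x v) (a-sym u x)))
          (sym (kernel-sucʳ i v u))

  -- Dominance against increasing test functions

  module Dominance (rank : Fin m → ℕ)
    (A-increasing : ∀ {w} → Increasing.Increasing rank w → Increasing.Increasing rank (A w)) where
    open Increasing rank

    infix 4 _≽_
    _≽_ : (Fin m → ℕ) → (Fin m → ℕ) → Set
    f ≽ g = ∀ {h} → Increasing h → ⟨ g , h ⟩ ≤ ⟨ f , h ⟩

    A^-increasing : ∀ i {w} → Increasing w → Increasing (A^ i w)
    A^-increasing zero    w↑ = w↑
    A^-increasing (suc i) w↑ = A-increasing (A^-increasing i w↑)

    q-increasing : ∀ i → Increasing (q i)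
    q-increasing i = A^-increasing i (λ _ → ≤-refl)

    -- Chebyshev applied to the kernel of the power, whose row sums are `q (suc i)`.
    A^-≼ : ∀ i {f} → Increasing f → f · q (suc i) ≽ A^ (suc i) f
    A^-≼ i {f} f↑ {h} h↑ =
      subst₂ _≤_
        (sum-cong-≗ λ u → cong (_* h u) (sym (A^-kernel i f u)))
        (sum-cong-≗ λ u → cong (λ s → f u * s * h u) (sym (q-kernel u)))
        (chebyshev (kernel i) (kernel-sym i) f↑ h↑)
      where
      q-kernel : ∀ u → q (suc i) u ≡ sum (kernel i u)
      q-kernel u = trans (A^-kernel i (const 1) u) (sum-cong-≗ λ v → *-identityʳ (kernel i u v))

    -- The invariant kept at each vertex during leaf removal, where `i` is the number of edges
    -- absorbed there so far. Monotonicity is carried along because `A g` becomes part of a test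
    -- function in `heavy-join`.
    record Heavy (w : Fin m → ℕ) (i : ℕ) : Set where
      field
        increasing : Increasing w
        dominates  : w ≽ q i

    open Heavy

    heavy-one : Heavy (const 1) 0
    heavy-one .increasing _ = ≤-refl
    heavy-one .dominates  _ = ≤-refl

    -- Chebyshev passes from `A^ (suc j) (q i)` to `q i · A (q j)`. The factors are then replaced
    -- one at a time: `q j` by `g`, after self-adjointness has moved `A` onto the test function, and
    -- `q i` by `f`, tested against `A g · h`.
    heavy-join : ∀ {f g i j} → Heavy f i → Heavy g j → Heavy (f · A g) (suc j + i)
    heavy-join {f} {g} {i} {j} F G .increasing =
      ·-increasing (F .increasing) (A-increasing (G .increasing))
    heavy-join {f} {g} {i} {j} F G .dominates {h} h↑ = begin
      ⟨ q (suc j + i) , h ⟩          ≡⟨ cong ⟨_, h ⟩ (A^-+ (suc j) i (const 1)) ⟩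
      ⟨ A^ (suc j) (q i) , h ⟩       ≤⟨ A^-≼ j (q-increasing i) h↑ ⟩
      ⟨ q i · A (q j) , h ⟩          ≡⟨ sum-cong-≗ (λ u → rotate (q i u) (A (q j) u) (h u)) ⟩
      ⟨ A (q j) , q i · h ⟩          ≡⟨ A-selfAdjoint (q j) (q i · h) ⟩
      ⟨ q j , A (q i · h) ⟩          ≤⟨ G .dominates (A-increasing (·-increasing (q-increasing i) h↑)) ⟩
      ⟨ g , A (q i · h) ⟩            ≡⟨ A-selfAdjoint g (q i · h) ⟨
      ⟨ A g , q i · h ⟩              ≡⟨ sum-cong-≗ (λ u → shift (A g u) (q i u) (h u)) ⟩
      ⟨ q i , A g · h ⟩              ≤⟨ F .dominates (·-increasing (A-increasing (G .increasing)) h↑) ⟩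
      ⟨ f , A g · h ⟩                ≡⟨ sum-cong-≗ (λ u → sym (*-assoc (f u) (A g u) (h u))) ⟩
      ⟨ f · A g , h ⟩                ∎
      where
      open ≤-Reasoning
      rotate : ∀ x y z → x * y * z ≡ y * (x * z)
      rotate = solve-∀
      shift : ∀ x y z → x * (y * z) ≡ y * (x * z)
      shift = solve-∀

-- Sums over all maps Fin n → Fin m

-- Maps are enumerated by the same codes as in `hom`, so the count there turns directly into such a
-- sum.
sumMaps : ∀ n → ((Fin n → Fin m) → ℕ) → ℕ
sumMaps {m} n F = sum {m ^ n} (λ c → F (finToFun c))

-- Needed because function extensionality is not available.
Extensional : ((Fin n → Fin m) → ℕ) → Set
Extensional F = ∀ {f g} → f ≗ g → F f ≡ F g

sumMaps-∷ : {F : (Fin (suc n) → Fin m) → ℕ} → Extensional F →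
            sumMaps (suc n) F ≡ sum (λ a → sumMaps n (λ f → F (a ∷ f)))
sumMaps-∷ {n} {m} {F} ext =
  trans (sum-combine {m} _)
        (sum-cong-≗ λ a → sum-cong-≗ λ c → ext (finToFun-combine a c))
  where
  finToFun-combine : ∀ (a : Fin m) (c : Fin (m ^ n)) →
                     finToFun {m} {suc n} (combine a c) ≗ (a ∷ finToFun c)
  finToFun-combine a c zero    = cong proj₁ (remQuot-combine {m} a c)
  finToFun-combine a c (suc i) = cong (λ r → finToFun (proj₂ r) i) (remQuot-combine {m} a c)

∷-≗ : ∀ {a : Fin m} {f g : Fin n → Fin m} → f ≗ g → (a ∷ f) ≗ (a ∷ g)
∷-≗ f≗g zero    = refl
∷-≗ f≗g (suc i) = f≗g i

insertAt-≗ : ∀ {f g : Fin n → Fin m} i {a} → f ≗ g → insertAt f i a ≗ insertAt g i a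
insertAt-≗ zero            f≗g zero    = refl
insertAt-≗ zero            f≗g (suc j) = f≗g j
insertAt-≗ {suc n} (suc i) f≗g zero    = f≗g zero
insertAt-≗ {suc n} (suc i) f≗g (suc j) = insertAt-≗ i (f≗g ∘ suc) j

-- Fubini for the coordinate `i`: the first coordinate is split off, the induction isolates the
-- wanted one behind it, and the two sums are exchanged.
sumMaps-insertAt : {F : (Fin (suc n) → Fin m) → ℕ} → Extensional F → ∀ i →
                   sumMaps (suc n) F ≡ sum (λ a → sumMaps n (λ f → F (insertAt f i a)))
sumMaps-insertAt {n} {m} ext zero =
  trans (sumMaps-∷ ext) (sum-cong-≗ {m} λ a → sum-cong-≗ {m ^ n} λ c →
    ext λ { zero → refl ; (suc j) → refl })
sumMaps-insertAt {suc n} {m} {F} ext (suc i) = begin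
  sumMaps (suc (suc n)) F
    ≡⟨ sumMaps-∷ ext ⟩
  sum (λ b → sumMaps (suc n) (λ f → F (b ∷ f)))
    ≡⟨ sum-cong-≗ {m} (λ b → sumMaps-insertAt (λ f≗g → ext (∷-≗ f≗g)) i) ⟩
  sum (λ b → sum (λ a → sumMaps n (λ f → F (b ∷ insertAt f i a))))
    ≡⟨ ∑-comm {m} {m} _ ⟩
  sum (λ a → sum (λ b → sumMaps n (λ f → F (b ∷ insertAt f i a))))
    ≡⟨ sum-cong-≗ {m} (λ a → sum-cong-≗ {m} λ b → sum-cong-≗ {m ^ n} λ c →
         ext λ { zero → refl ; (suc j) → refl }) ⟩
  sum (λ a → sum (λ b → sumMaps n (λ f → F (insertAt (b ∷ f) (suc i) a))))
    ≡⟨ sum-cong-≗ {m} (λ a → sym (sumMaps-∷ λ f≗g → ext (insertAt-≗ (suc i) f≗g))) ⟩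
  sum (λ a → sumMaps (suc n) (λ f → F (insertAt f (suc i) a))) ∎
  where open ≡-Reasoning

-- Leaves

data PunchView (i : Fin (suc n)) : Fin (suc n) → Set where
  hole   : PunchView i i
  punch  : ∀ j → PunchView i (punchIn i j)

punchView : (i j : Fin (suc n)) → PunchView i j
punchView i j with i ≟ j
... | yes refl = hole
... | no  i≢j  = subst (PunchView i) (punchIn-punchOut i≢j) (punch (punchOut i≢j))

module _ (G : SimpleGraph n) where
  open SimpleGraph G

  first-edge : ∀ {u v} → u ≢ v → Star _∼_ u v → ∃₂ λ u v → u ∼ v
  first-edge u≢u ε         = contradiction refl u≢u
  first-edge _   (u∼v ◅ _) = _ , _ , u∼v

  IsLeafAt : Fin n → Fin n → Set
  IsLeafAt ℓ p = ℓ ∼ p × (∀ x → ℓ ∼ x → x ≡ p)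

  isLeafAt? : ∀ ℓ p → Dec (IsLeafAt ℓ p)
  isLeafAt? ℓ p = (ℓ ∼? p) ×-dec all? (λ x → (ℓ ∼? x) →-dec (x ≟ p))

-- A relation instead of the function `delete`, so that the shorter path itself can serve as the
-- path minus its end vertex.
record DeletesLeaf (G : SimpleGraph (suc n)) (ℓ : Fin (suc n)) (p : Fin n)
                   (G′ : SimpleGraph n) : Set where
  private
    module G  = SimpleGraph G
    module G′ = SimpleGraph G′
  field
    leaf : IsLeafAt G ℓ (punchIn ℓ p)
    edge : ∀ x y → x G′.∼ y ⇔ punchIn ℓ x G.∼ punchIn ℓ y

delete : SimpleGraph (suc n) → Fin (suc n) → SimpleGraph n
delete G ℓ = record
  { graph = record
    { _∼_   = λ x y → punchIn ℓ x ∼ punchIn ℓ y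
    ; _∼?_  = λ x y → punchIn ℓ x ∼? punchIn ℓ y
    ; ∼-sym = ∼-sym
    }
  ; loopless = loopless
  }
  where open SimpleGraph G

module _ (G : SimpleGraph (suc n)) {ℓ : Fin (suc n)} {p : Fin n}
         (ℓ-leaf : IsLeafAt G ℓ (punchIn ℓ p)) where
  private
    module G = SimpleGraph G
    module G′ = SimpleGraph (delete G ℓ)

  delete-deletesLeaf : DeletesLeaf G ℓ p (delete G ℓ)
  delete-deletesLeaf = record { leaf = ℓ-leaf ; edge = λ _ _ → mk⇔ id id }

  delete-acyclic : Acyclic G → Acyclic (delete G ℓ)
  delete-acyclic acyclic c = acyclic record
    { ℓ        = C.ℓ
    ; vertex   = punchIn ℓ ∘ C.vertex
    ; distinct = λ eq → C.distinct (punchIn-injective ℓ _ _ eq)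
    ; step     = C.step
    ; close    = C.close
    }
    where module C = Cycle c

  -- The retraction of G onto G − ℓ that sends ℓ to its neighbour maps walks to walks.
  delete-connected : Connected G → Connected (delete G ℓ)
  delete-connected connected x y =
    subst₂ (Star G′._∼_) (retract-punchIn x) (retract-punchIn y) (walk (connected _ _))
    where
    retractView : ∀ {z} → PunchView ℓ z → Fin n
    retractView hole      = p
    retractView (punch j) = j
    retract : Fin (suc n) → Fin n
    retract z = retractView (punchView ℓ z)
    retractView-punchIn : ∀ {z} j → z ≡ punchIn ℓ j → (v : PunchView ℓ z) → retractView v ≡ j
    retractView-punchIn j eq hole      = contradiction (sym eq) (punchInᵢ≢i ℓ j)
    retractView-punchIn j eq (punch i) = punchIn-injective ℓ i j eq
    retract-punchIn : ∀ j → retract (punchIn ℓ j) ≡ j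
    retract-punchIn j = retractView-punchIn j refl (punchView ℓ (punchIn ℓ j))
    edge : ∀ {x y} → x G.∼ y → (v : PunchView ℓ x) (w : PunchView ℓ y) →
           Star G′._∼_ (retractView v) (retractView w)
    edge x∼y hole      hole      = ε
    -- The only neighbour of `ℓ` is `punchIn ℓ p`, so an edge at `ℓ` collapses to the empty walk at
    -- `p`.
    edge x∼y hole      (punch j) =
      subst (Star _ p) (punchIn-injective ℓ p j (sym (proj₂ ℓ-leaf _ x∼y))) ε
    edge x∼y (punch i) hole      =
      subst (λ z → Star _ z p) (punchIn-injective ℓ p i (sym (proj₂ ℓ-leaf _ (G.∼-sym x∼y)))) ε
    edge x∼y (punch i) (punch j) = x∼y ◅ ε
    walk : ∀ {x y} → Star G._∼_ x y → Star G′._∼_ (retract x) (retract y)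
    walk ε          = ε
    walk (x∼y ◅ xs) = edge x∼y (punchView ℓ _) (punchView ℓ _) ◅◅ walk xs

-- Existence of leaves in acyclic graphs

module _ (G : SimpleGraph n) (acyclic : Acyclic G) where
  open SimpleGraph G

  -- If there were no leaf, every arc could be continued without turning back. The resulting
  -- infinite walk never revisits a vertex, which is absurd in a finite graph.
  module NonBacktrackingWalk
    (extend : ∀ u v → u ∼ v → ∃[ w ] v ∼ w × w ≢ u)
    (start : ∃₂ λ u v → u ∼ v) where

    arc : ℕ → ∃₂ λ u v → u ∼ v
    arc zero    = start
    arc (suc i) = proj₁ (proj₂ (arc i)) , w , v∼w
      where
      w = proj₁ (extend _ _ (proj₂ (proj₂ (arc i))))
      v∼w = proj₁ (proj₂ (extend _ _ (proj₂ (proj₂ (arc i)))))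

    vertex : ℕ → Fin n
    vertex i = proj₁ (arc i)

    step : ∀ i → vertex i ∼ vertex (suc i)
    step i = proj₂ (proj₂ (arc i))

    non-backtracking : ∀ i → vertex (2 + i) ≢ vertex i
    non-backtracking i = proj₂ (proj₂ (extend _ _ (proj₂ (proj₂ (arc i)))))

    -- A return after the fewest possible steps closes up to a cycle.
    no-return : ∀ d i → vertex (suc d + i) ≢ vertex i
    no-return = <-rec _ go
      where
      go : ∀ d → (∀ {e} → e < d → ∀ i → vertex (suc e + i) ≢ vertex i) →
           ∀ i → vertex (suc d + i) ≢ vertex i
      -- A return takes `suc d` steps. One step would be a loop and two would backtrack; from three
      -- on the closed walk has the length of a `Cycle`.
      go 0 rec i eq = loopless (subst (vertex i ∼_) eq (step i))
      go 1 rec i eq = non-backtracking i eq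
      go (suc (suc ℓ)) rec i eq = acyclic record
        { ℓ        = ℓ
        ; vertex   = λ j → vertex (toℕ j + i)
        ; distinct = λ {x} {y} → injective x y
        ; step     = λ j → subst (λ t → vertex (t + i) ∼ vertex (suc (toℕ j) + i))
                             (sym (toℕ-inject₁ j)) (step (toℕ j + i))
        ; close    = subst₂ _∼_ (cong (λ t → vertex (t + i)) (sym (toℕ-fromℕ (2 + ℓ)))) eq
                       (step (2 + ℓ + i))
        }
        where
        -- A repetition among these vertices would be a return in `suc o` steps, fewer than the
        -- `3 + ℓ` under consideration.
        separate : (x y : Fin (3 + ℓ)) → toℕ x < toℕ y → vertex (toℕ y + i) ≢ vertex (toℕ x + i)
        separate x y x<y
          with o , x+o≡y ← m≤n⇒∃[o]m+o≡n x<y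
          with so+x≡y ← trans (cong suc (+-comm o (toℕ x))) x+o≡y =
          λ e → rec o<2+ℓ (toℕ x + i) (trans (cong vertex (reassoc so+x≡y)) e)
          where
          reassoc : suc o + toℕ x ≡ toℕ y → suc o + (toℕ x + i) ≡ toℕ y + i
          reassoc h = trans (sym (+-assoc (suc o) (toℕ x) i)) (cong (_+ i) h)
          o<2+ℓ : o < 2 + ℓ
          o<2+ℓ = s≤s⁻¹ (≤-<-trans (≤-trans (m≤m+n (suc o) (toℕ x)) (≤-reflexive so+x≡y)) (toℕ<n y))
        injective : ∀ x y → vertex (toℕ x + i) ≡ vertex (toℕ y + i) → x ≡ y
        injective x y e with <-cmp (toℕ x) (toℕ y)
        ... | tri< x<y _ _ = contradiction (sym e) (separate x y x<y)
        ... | tri≈ _ x≡y _ = toℕ-injective x≡y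
        ... | tri> _ _ y<x = contradiction e (separate y x y<x)

    -- Two of the first `suc n` vertices of the walk coincide by the pigeonhole principle.
    impossible : ⊥
    impossible with i , j , i<j , eq ← pigeonhole (n<1+n n) (vertex ∘ toℕ)
               with o , i+o≡j ← m≤n⇒∃[o]m+o≡n i<j =
      no-return o (toℕ i) (trans (cong vertex (trans (cong suc (+-comm o (toℕ i))) i+o≡j)) (sym eq))

  leaf-exists : (∃₂ λ u v → u ∼ v) → ∃₂ λ ℓ p → IsLeafAt G ℓ p
  leaf-exists start with any? (λ ℓ → any? (isLeafAt? G ℓ))
  ... | yes leaf  = leaf
  ... | no  ¬leaf = contradiction start (NonBacktrackingWalk.impossible extend)
    where
    extend : ∀ u v → u ∼ v → ∃[ w ] v ∼ w × w ≢ u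
    extend u v u∼v
      -- As `v` is adjacent to `u`, only uniqueness of the neighbour can fail for `v`, and a witness
      -- of the failure continues the walk.
      with w , ¬w ← ¬∀⟶∃¬ _ _ (λ x → (v ∼? x) →-dec (x ≟ u))
                      (λ only → ¬leaf (v , u , ∼-sym u∼v , only)) =
      w , decidable-stable (v ∼? w) (λ v≁w → ¬w λ v∼w → contradiction v∼w v≁w)
        , λ w≡u → ¬w (const w≡u)

-- A walk between two distinct vertices supplies an edge and hence a leaf. By looplessness its
-- neighbour is another vertex, so it survives the deletion.
tree-deletesLeaf : (G : SimpleGraph (2 + n)) → IsTree G →
                   ∃₂ λ ℓ p → DeletesLeaf G ℓ p (delete G ℓ) × IsTree (delete G ℓ)
tree-deletesLeaf G (connected , acyclic)
  with leaf-exists G acyclic (first-edge G (λ ()) (connected zero (suc zero)))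
... | ℓ , p , leaf with punchView ℓ p
...   | hole    = contradiction (proj₁ leaf) (SimpleGraph.loopless G)
...   | punch p = ℓ , p , delete-deletesLeaf G leaf
                , delete-connected G leaf connected , delete-acyclic G leaf acyclic

-- Paths

path-deletesLeaf : ∀ n → DeletesLeaf (path (2 + n)) zero zero (path (suc n))
path-deletesLeaf n = record
  { leaf = inj₁ refl , λ where
      zero          (inj₁ ())
      zero          (inj₂ ())
      (suc zero)    _        → refl
      (suc (suc x)) (inj₁ ())
      (suc (suc x)) (inj₂ ())
  ; edge = λ x y → mk⇔
      (λ { (inj₁ eq) → inj₁ (cong suc eq) ; (inj₂ eq) → inj₂ (cong suc eq) })
      (λ { (inj₁ eq) → inj₁ (suc-injective eq) ; (inj₂ eq) → inj₂ (suc-injective eq) })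
  }

path-connected : ∀ n → Connected (path n)
path-connected (suc n) = connected
  where
  open SimpleGraph (path (suc n)) using (_∼_)
  lift : ∀ {u v} → Star (SimpleGraph._∼_ (path n)) u v → Star _∼_ (suc u) (suc v)
  lift = gmap suc λ { (inj₁ eq) → inj₁ (cong suc eq) ; (inj₂ eq) → inj₂ (cong suc eq) }
  connected : ∀ u v → Star _∼_ u v
  connected zero          zero          = ε
  connected zero          (suc zero)    = inj₁ refl ◅ ε
  connected zero          (suc v@(suc _)) = inj₁ refl ◅ lift (path-connected n zero v)
  connected (suc zero)    zero          = inj₂ refl ◅ ε
  connected (suc u@(suc _)) zero        = lift (path-connected n u zero) ◅◅ inj₂ refl ◅ ε
  connected (suc u)       (suc v)       = lift (path-connected n u v)

module _ {G : SimpleGraph n} (C : Cycle G) where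
  open SimpleGraph G
  open Cycle C

  -- These are the predecessor and the successor along the cycle, with `close` used at the last and
  -- the first index. They differ because the length is at least three.
  cycle-neighbours : ∀ i → ∃₂ λ j k → j ≢ k × vertex i ∼ vertex j × vertex i ∼ vertex k
  cycle-neighbours i with view i
  ... | ‵fromℕ = inject₁ (fromℕ _) , zero , (λ ()) , ∼-sym (step _) , close
  ... | ‵inject₁ zero = suc zero , fromℕ _ , (λ ()) , step zero , ∼-sym close
  ... | ‵inject₁ (suc j) = inject₁ (inject₁ j) , suc (suc j) , inject₁²≢suc² j
                         , ∼-sym (step (inject₁ j)) , step (suc j)
    where
    inject₁²≢suc² : ∀ {n} (j : Fin n) → inject₁ (inject₁ j) ≢ suc (suc j)
    inject₁²≢suc² (suc j) eq = inject₁²≢suc² j (Fin-suc-injective eq)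

-- A lowest vertex of a cycle would have two distinct upper neighbours.
path-acyclic : ∀ n → Acyclic (path n)
path-acyclic n C = <-rec (λ h → ∀ i → toℕ (vertex i) ≡ h → ⊥) go _ zero refl
  where
  open Cycle C
  go : ∀ h → (∀ {h′} → h′ < h → ∀ i → toℕ (vertex i) ≡ h′ → ⊥) → ∀ i → toℕ (vertex i) ≡ h → ⊥
  go h lower i refl with cycle-neighbours C i
  ... | j , k , j≢k , inj₁ up , inj₁ up′ =
    j≢k (distinct (toℕ-injective (trans (sym up) up′)))
  ... | j , k , _ , inj₂ down , _ = lower (≤-reflexive down) j refl
  ... | j , k , _ , inj₁ _ , inj₂ down = lower (≤-reflexive down) k refl

path-isTree : ∀ n → IsTree (path n)
path-isTree n = path-connected n , path-acyclic n

-- Weighted colorings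

module _ {m} (H : TargetGraph m) where
  private module H = Graph H

  adjacency : Fin m → Fin m → ℕ
  adjacency u v = ι (u H.∼? v)

  adjacency-sym : ∀ u v → adjacency u v ≡ adjacency v u
  adjacency-sym u v = ι-⇔ (mk⇔ H.∼-sym H.∼-sym) (u H.∼? v) (v H.∼? u)

  open SymmetricKernel adjacency adjacency-sym

  term : SimpleGraph n → (Fin n → Fin m → ℕ) → (Fin n → Fin m) → ℕ
  term G w f = ι (isColoring? G H f) * product (λ v → w v (f v))

  weightedHom : SimpleGraph n → (Fin n → Fin m → ℕ) → ℕ
  weightedHom {n} G w = sumMaps n (term G w)

  isColoring-≗ : (G : SimpleGraph n) → ∀ {f g} → f ≗ g → IsColoring G H f → IsColoring G H g
  isColoring-≗ G f≗g col u v u∼v = subst₂ H._∼_ (f≗g u) (f≗g v) (col u v u∼v)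

  term-extensional : (G : SimpleGraph n) (w : Fin n → Fin m → ℕ) → Extensional (term G w)
  term-extensional G w f≗g =
    cong₂ _*_
      (ι-⇔ (mk⇔ (isColoring-≗ G f≗g) (isColoring-≗ G (sym ∘ f≗g)))
           (isColoring? G H _) (isColoring? G H _))
      (product-cong-≗ λ v → cong (w v) (f≗g v))

  hom-weighted : (G : SimpleGraph n) → hom G H ≡ weightedHom G (const (const 1))
  hom-weighted {n} G =
    trans (count-tabulate (λ c → isColoring? G H (finToFun c)) id)
          (sum-cong-≗ λ c → sym (trans
            (cong (ι (isColoring? G H (finToFun {m} {n} c)) *_) (product-replicate-one n))
            (*-identityʳ _)))

  weightedHom-cong : (G : SimpleGraph n) {w w′ : Fin n → Fin m → ℕ} → (∀ v c → w v c ≡ w′ v c) →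
                     weightedHom G w ≡ weightedHom G w′
  weightedHom-cong {n} G w≡w′ = sum-cong-≗ λ c →
    cong (ι (isColoring? G H (finToFun {m} {n} c)) *_) (product-cong-≗ λ v → w≡w′ v (finToFun c v))

  weightedHom-vertex : (G : SimpleGraph 1) (w : Fin 1 → Fin m → ℕ) → weightedHom G w ≡ sum (w zero)
  -- The inner sum runs over the `m ^ 0 = 1` maps on no vertices, which leaves a trailing `+ 0`.
  weightedHom-vertex G w = trans (sumMaps-∷ (term-extensional G w)) (sum-cong-≗ {m} λ a →
    trans (+-identityʳ _) (value (a ∷ finToFun {m} {0} zero)))
    where
    open ≡-Reasoning
    coloring : ∀ f → IsColoring G H f
    coloring f zero zero loop = contradiction loop (SimpleGraph.loopless G)
    value : ∀ f → term G w f ≡ w zero (f zero)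
    value f = begin
      term G w f
        ≡⟨ cong (λ b → (if b then 1 else 0) * product (λ v → w v (f v)))
             (dec-true (isColoring? G H f) (coloring f)) ⟩
      1 * (w zero (f zero) * 1)
        ≡⟨ trans (*-identityˡ _) (*-identityʳ _) ⟩
      w zero (f zero) ∎

  absorb : (Fin (suc n) → Fin m → ℕ) → Fin (suc n) → Fin n → Fin n → Fin m → ℕ
  absorb w ℓ p = updateAt (removeAt w ℓ) p (_· A (w ℓ))

  module _ {G : SimpleGraph (suc n)} {G′ : SimpleGraph n} {ℓ p} (del : DeletesLeaf G ℓ p G′) where
    private
      module G  = SimpleGraph G
      module G′ = SimpleGraph G′
    open DeletesLeaf del

    -- The only edge at `ℓ` goes to `p`; all other edges are those of `G′`.
    isColoring-insertAt : ∀ f a → IsColoring G H (insertAt f ℓ a) ⇔ (IsColoring G′ H f × f p H.∼ a)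
    isColoring-insertAt f a = mk⇔ to from
      where
      at-ℓ : insertAt f ℓ a ℓ ≡ a
      at-ℓ = insertAt-lookup f ℓ a
      at-punchIn : ∀ x → insertAt f ℓ a (punchIn ℓ x) ≡ f x
      at-punchIn = insertAt-punchIn f ℓ a
      to : IsColoring G H (insertAt f ℓ a) → IsColoring G′ H f × f p H.∼ a
      to col =
        (λ x y x∼y → subst₂ H._∼_ (at-punchIn x) (at-punchIn y)
                       (col _ _ (Equivalence.to (edge x y) x∼y))) ,
        subst₂ H._∼_ (at-punchIn p) at-ℓ (col _ _ (G.∼-sym (proj₁ leaf)))
      from : IsColoring G′ H f × f p H.∼ a → IsColoring G H (insertAt f ℓ a)
      from (col , fp∼a) x y x∼y with punchView ℓ x | punchView ℓ y
      ... | hole    | hole    = contradiction x∼y G.loopless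
      ... | punch x | punch y =
        subst₂ H._∼_ (sym (at-punchIn x)) (sym (at-punchIn y))
          (col x y (Equivalence.from (edge x y) x∼y))
      ... | hole    | punch y rewrite punchIn-injective ℓ y p (proj₂ leaf _ x∼y) =
        subst₂ H._∼_ (sym at-ℓ) (sym (at-punchIn p)) (H.∼-sym fp∼a)
      ... | punch x | hole    rewrite punchIn-injective ℓ x p (proj₂ leaf _ (G.∼-sym x∼y)) =
        subst₂ H._∼_ (sym (at-punchIn p)) (sym at-ℓ) fp∼a

    term-insertAt : ∀ w f a → term G w (insertAt f ℓ a) ≡
                              term G′ (removeAt w ℓ) f * (adjacency (f p) a * w ℓ a)
    term-insertAt w f a = begin
      term G w (insertAt f ℓ a)
        ≡⟨ cong₂ _*_
             (trans (ι-⇔ (isColoring-insertAt f a) (isColoring? G H _)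
                         (isColoring? G′ H f ×-dec (f p H.∼? a)))
                    (ι-× (isColoring? G′ H f) (f p H.∼? a)))
             (trans (product-remove {i = ℓ} (λ x → w x (insertAt f ℓ a x)))
                    (cong₂ _*_ (cong (w ℓ) (insertAt-lookup f ℓ a))
                       (product-cong-≗ {n} λ x → cong (w (punchIn ℓ x)) (insertAt-punchIn f ℓ a x)))) ⟩
      ι (isColoring? G′ H f) * adjacency (f p) a * (w ℓ a * product (λ x → w (punchIn ℓ x) (f x)))
        ≡⟨ regroup (ι (isColoring? G′ H f)) (adjacency (f p) a) (w ℓ a) _ ⟩
      term G′ (removeAt w ℓ) f * (adjacency (f p) a * w ℓ a) ∎
      where
      open ≡-Reasoning
      regroup : ∀ x y z t → x * y * (z * t) ≡ x * t * (y * z)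
      regroup = solve-∀

    -- With the coloring `f` of the remaining vertices fixed, summing over the color of `ℓ` produces
    -- the factor `A (w ℓ) (f p)`, which joins the weight of `p`.
    weightedHom-absorb : ∀ w → weightedHom G w ≡ weightedHom G′ (absorb w ℓ p)
    weightedHom-absorb w = begin
      sumMaps (suc n) (term G w)
        ≡⟨ sumMaps-insertAt (term-extensional G w) ℓ ⟩
      sum (λ a → sumMaps n (λ f → term G w (insertAt f ℓ a)))
        ≡⟨ ∑-comm {m} {m ^ n} _ ⟩
      sumMaps n (λ f → sum (λ a → term G w (insertAt f ℓ a)))
        ≡⟨ sum-cong-≗ {m ^ n} (λ c → collect (finToFun c)) ⟩
      sumMaps n (term G′ (absorb w ℓ p)) ∎
      where
      open ≡-Reasoning
      collect : ∀ f → sum (λ a → term G w (insertAt f ℓ a)) ≡ term G′ (absorb w ℓ p) f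
      collect f = begin
        sum (λ a → term G w (insertAt f ℓ a))
          ≡⟨ sum-cong-≗ (term-insertAt w f) ⟩
        sum (λ a → term G′ (removeAt w ℓ) f * (adjacency (f p) a * w ℓ a))
          ≡⟨ *-distribˡ-sum {m} (term G′ (removeAt w ℓ) f) _ ⟨
        term G′ (removeAt w ℓ) f * A (w ℓ) (f p)
          ≡⟨ *-assoc (ι (isColoring? G′ H f)) (product (λ x → w (punchIn ℓ x) (f x))) _ ⟩
        ι (isColoring? G′ H f) * (product (λ x → w (punchIn ℓ x) (f x)) * A (w ℓ) (f p))
          ≡⟨ cong (ι (isColoring? G′ H f) *_) (product-updateAt (removeAt w ℓ) p (A (w ℓ)) f) ⟨
        term G′ (absorb w ℓ p) f ∎

  -- Counting on the path and bounding on trees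

  -- The weights left on a path after `i` successive end vertices of a longer unweighted path have
  -- been absorbed.
  rootWeight : ℕ → Fin (suc n) → Fin m → ℕ
  rootWeight i = q i ∷ const (const 1)

  -- Absorbing the first vertex turns `q i` into `A (q i)`, which is `q (suc i)`; the general `i`
  -- makes the induction go through.
  weightedHom-path : ∀ n i → weightedHom (path (suc n)) (rootWeight i) ≡ sum (q (n + i))
  weightedHom-path zero    i = weightedHom-vertex (path 1) (rootWeight i)
  weightedHom-path (suc n) i = begin
    weightedHom (path (2 + n)) (rootWeight i)
      ≡⟨ weightedHom-absorb (path-deletesLeaf n) (rootWeight i) ⟩
    weightedHom (path (suc n)) (absorb (rootWeight i) zero zero)
      ≡⟨ weightedHom-cong (path (suc n)) {absorb (rootWeight i) zero zero} {rootWeight (suc i)}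
           absorb-rootWeight ⟩
    weightedHom (path (suc n)) (rootWeight (suc i))
      ≡⟨ weightedHom-path n (suc i) ⟩
    sum (q (n + suc i))
      ≡⟨ cong (sum ∘ q) (+-suc n i) ⟩
    sum (q (suc n + i)) ∎
    where
    open ≡-Reasoning
    absorb-rootWeight : ∀ v c → absorb (rootWeight {suc n} i) zero zero v c ≡ rootWeight (suc i) v c
    absorb-rootWeight zero    c = *-identityˡ _
    absorb-rootWeight (suc v) c = refl

  hom-path : ∀ n → hom (path (suc n)) H ≡ sum (q n)
  hom-path n = begin
    hom (path (suc n)) H
      ≡⟨ hom-weighted (path (suc n)) ⟩
    weightedHom (path (suc n)) (const (const 1))
      ≡⟨ weightedHom-cong (path (suc n)) {const (const 1)} {rootWeight 0} one-rootWeight ⟩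
    weightedHom (path (suc n)) (rootWeight 0)
      ≡⟨ weightedHom-path n 0 ⟩
    sum (q (n + 0))
      ≡⟨ cong (sum ∘ q) (+-identityʳ n) ⟩
    sum (q n) ∎
    where
    open ≡-Reasoning
    one-rootWeight : ∀ v c → 1 ≡ rootWeight {n} 0 v c
    one-rootWeight zero    c = refl
    one-rootWeight (suc v) c = refl

  module _ (rank : Fin m → ℕ)
    (A-increasing : ∀ {w} → Increasing.Increasing rank w → Increasing.Increasing rank (A w)) where
    open Dominance rank A-increasing

    -- Here `n` counts the edges still present and `e v` those absorbed into `v`. Removing a leaf
    -- keeps `n + sum e` fixed, so the bound is the same throughout; on one vertex it is dominance
    -- tested against the constant one.
    weightedHom-tree : ∀ n (G : SimpleGraph (suc n)) → IsTree G → ∀ w e →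
                       (∀ v → Heavy (w v) (e v)) →
                       sum (q (n + sum e)) ≤ weightedHom G w
    weightedHom-tree zero G tree w e heavy = begin
      sum (q (e zero + 0))           ≡⟨ cong (sum ∘ q) (+-identityʳ (e zero)) ⟩
      sum (q (e zero))               ≡⟨ sum-cong-≗ (λ u → *-identityʳ (q (e zero) u)) ⟨
      ⟨ q (e zero) , const 1 ⟩       ≤⟨ Heavy.dominates (heavy zero) (λ _ → ≤-refl) ⟩
      ⟨ w zero , const 1 ⟩           ≡⟨ sum-cong-≗ (λ u → *-identityʳ (w zero u)) ⟩
      sum (w zero)                   ≡⟨ weightedHom-vertex G w ⟨
      weightedHom G w                ∎
      where open ≤-Reasoning
    weightedHom-tree (suc n) G tree w e heavy
      with ℓ , p , del , tree′ ← tree-deletesLeaf G tree = begin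
      sum (q (suc n + sum e))        ≡⟨ cong (λ s → sum (q s)) exponent ⟨
      sum (q (n + sum e′))           ≤⟨ weightedHom-tree n (delete G ℓ) tree′ (absorb w ℓ p) e′ heavy′ ⟩
      weightedHom (delete G ℓ) (absorb w ℓ p) ≡⟨ weightedHom-absorb del w ⟨
      weightedHom G w                ∎
      where
      open ≤-Reasoning
      -- The edges absorbed into `ℓ` pass to `p` together with the edge joining the two, hence the
      -- `suc`.
      e′ = updateAt (removeAt e ℓ) p (suc (e ℓ) +_)
      exponent : n + sum e′ ≡ suc n + sum e
      exponent = trans (cong (n +_) (trans (sum-updateAt-+ (removeAt e ℓ) p (suc (e ℓ)))
                                           (cong suc (sym (sum-remove {i = ℓ} e)))))
                       (+-suc n (sum e))
      heavy-updateAt : ∀ {n} (p : Fin n) {w e i} {g : Fin m → ℕ} →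
                       (∀ v → Heavy (w v) (e v)) → Heavy g i →
                       ∀ v → Heavy (updateAt w p (_· A g) v) (updateAt e p (suc i +_) v)
      heavy-updateAt zero    hs h zero    = heavy-join (hs zero) h
      heavy-updateAt zero    hs h (suc v) = hs (suc v)
      heavy-updateAt (suc p) hs h zero    = hs zero
      heavy-updateAt (suc p) hs h (suc v) = heavy-updateAt p (hs ∘ suc) h v
      heavy′ : ∀ v → Heavy (absorb w ℓ p v) (e′ v)
      heavy′ = heavy-updateAt p (heavy ∘ punchIn ℓ) (heavy ℓ)

    hom-tree : ∀ n (G : SimpleGraph (suc n)) → IsTree G → hom (path (suc n)) H ≤ hom G H
    hom-tree n G tree = begin
      hom (path (suc n)) H               ≡⟨ hom-path n ⟩
      sum (q n)                          ≡⟨ cong (sum ∘ q) (+-identityʳ n) ⟨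
      sum (q (n + 0))                    ≡⟨ cong (λ s → sum (q (n + s))) (sum-replicate-zero (suc n)) ⟨
      sum (q (n + sum {suc n} (const 0))) ≤⟨ weightedHom-tree n G tree _ (const 0) (λ _ → heavy-one) ⟩
      weightedHom G (const (const 1))    ≡⟨ hom-weighted G ⟨
      hom G H                            ∎
      where open ≤-Reasoning

-- The increasing columns property

module _ {m k} (H : TargetGraph m) (𝒪 : ClassOrdering H k) where
  open Graph H
  open ClassOrdering 𝒪
  open SymmetricKernel (adjacency H) (adjacency-sym H)
  open Increasing (toℕ ∘ class)

  increasing-representative : ∀ {w} → Increasing w → ∀ v → w (representative (class v)) ≡ w v
  increasing-representative w↑ v = ≤-antisym (w↑ (≤-reflexive eq)) (w↑ (≤-reflexive (sym eq)))
    where eq = cong toℕ (proj₂ (class-surjective (class v)))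

  -- The neighbours of `u` are grouped by class, and `w` takes on each class its value at the
  -- representative.
  A-similarityMatrix : ∀ {w} → Increasing w → ∀ u →
    A w u ≡ sum (λ j → similarityMatrix H 𝒪 (class u) j * w (representative j))
  A-similarityMatrix {w} w↑ u = sym (begin
    sum (λ j → similarityMatrix H 𝒪 (class u) j * ŵ j)
      ≡⟨ sum-cong-≗ (λ j → cong (_* ŵ j) (row j)) ⟩
    sum (λ j → sum (λ v → adjacency H u v * ι (class v ≟ j)) * ŵ j)
      ≡⟨ sum-*-assoc (adjacency H u) (λ v j → ι (class v ≟ j)) ŵ ⟨
    sum (λ v → adjacency H u v * sum (λ j → ι (class v ≟ j) * ŵ j))
      ≡⟨ sum-cong-≗ (λ v → cong (adjacency H u v *_)
           (trans (sum-ι-≟ (class v) ŵ) (increasing-representative w↑ v))) ⟩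
    A w u ∎)
    where
    open ≡-Reasoning
    ŵ = w ∘ representative
    row : ∀ j → similarityMatrix H 𝒪 (class u) j ≡ sum (λ v → adjacency H u v * ι (class v ≟ j))
    row j = begin
      similarityMatrix H 𝒪 (class u) j
        ≡⟨ similarityMatrix-class H 𝒪 u j ⟩
      neighboursIn u j
        ≡⟨ count-tabulate (neighbourInClass? u j) id ⟩
      sum (λ v → ι (neighbourInClass? u j v))
        ≡⟨ sum-cong-≗ (λ v → ι-× (u ∼? v) (class v ≟ j)) ⟩
      sum (λ v → adjacency H u v * ι (class v ≟ j)) ∎

  -- `A w` at a vertex pairs the matrix row of its class with the monotone values of `w` on the
  -- classes, so Abel summation reduces the claim to tail sums of rows.
  A-increasing : IncreasingColumns (similarityMatrix H 𝒪) → ∀ {w} → Increasing w → Increasing (A w)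
  A-increasing columns {w} w↑ {u} {v} u≤v =
    subst₂ _≤_ (sym (A-similarityMatrix w↑ u)) (sym (A-similarityMatrix w↑ v))
      (tailSum-dominance {g = w ∘ representative} monotone λ c →
        -- The hypothesis compares consecutive rows only; chaining it reaches any two classes in
        -- order.
        steps⇒Monotone (λ i → tailSum c (similarityMatrix H 𝒪 i)) (columns c) u≤v)
    where
    class-representative : ∀ i → class (representative i) ≡ i
    class-representative i = proj₂ (class-surjective i)
    monotone : Monotone (w ∘ representative)
    monotone {i} {j} i≤j =
      w↑ (subst₂ _≤_ (cong toℕ (sym (class-representative i)))
                     (cong toℕ (sym (class-representative j))) i≤j)

theorem1p5 : ∀ {m : ℕ} (H : TargetGraph m) →
    (∃[ k ] ∃[ 𝒪 ] IncreasingColumns (similarityMatrix {m} {k} H 𝒪)) →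
    HoffmanLondon H
theorem1p5 H (k , 𝒪 , columns) (suc n) =
  (path (suc n) , path-isTree (suc n) , refl) ,
  hom-tree H (toℕ ∘ ClassOrdering.class 𝒪) (A-increasing H 𝒪 columns) n
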